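{- Every locally nilpotent group is an epimorphic image of a pseudo-free locally nilpotent group; that is, for every locally nilpotent group $G$ there are a set $M$, an increasing function $c\colon[M]^{<\aleph_0}\to\omega$ and a surjective group homomorphism $\mathrm{Fr}(M,c)\to G$.
   Context: A group is locally nilpotent if every finitely generated subgroup of it is nilpotent. $[M]^{<\aleph_0}$ denotes the family of all finite subsets of $M$. A function $c\colon [M]^{<\aleph_0}\to\omega$ is increasing if $U\subseteq V$ implies $c(U)\le c(V)$. For a group $G$, the lower central series is indexed by $G^0=G$ and $G^{n+1}=[G^n,G]$. For $U\subseteq M$ let $F_U=\langle x_m\mid m\in U\rangle$ be the free group freely generated by the elements $x_m$ ($m\in U$), regarded as a subgroup of $F=F_M$. The pseudo-free locally nilpotent group is $\mathrm{Fr}(M,c)=F/K$, where $K=K(M,c)$ is the normal subgroup of $F$ generated by $\bigcup_{U\in[M]^{<\aleph_0}} F_U^{c(U)}$, with $F_U^{c(U)}$ the $c(U)$-th term of the lower central series of $F_U$, indexed by $F_U^0=F_U$ and $F_U^{n+1}=[F_U^n,F_U]$. -}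

module Defs where

open import Algebra.Bundles using (Group)
import Algebra.Morphism.Structures as Morphisms
import Algebra.Properties.Group as GroupProperties
open import Algebra.Structures using (IsGroup)
open import Data.List.Base using (List)
import Data.List.Membership.Setoid as SetoidMembership
open import Data.List.Membership.Propositional using () renaming (_∈_ to _∈ₗ_)
open import Data.List.Relation.Binary.Subset.Propositional using () renaming (_⊆_ to _⊆ₗ_)
open import Data.Nat.Base using (ℕ; zero; suc; _≤_)
open import Data.Product.Base using (∃-syntax; _×_; _,_)
open import Function.Definitions using (Surjective)
open import Level using (Level; _⊔_) renaming (suc to lsuc)
open import Relation.Binary.Core using (Rel)
open import Relation.Binary.PropositionalEquality.Core using (_≡_)
import Relation.Binary.Reasoning.Setoid as SetoidReasoning
open import Relation.Unary using (Pred; _∈_; _≐_)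

module _ {c ℓ} (G : Group c ℓ) where
  open Group G
  open SetoidMembership setoid using () renaming (_∈_ to _∈ˡ_)

  data Generated {s} (S : Pred Carrier s) : Pred Carrier (c ⊔ ℓ ⊔ s) where
    gen   : ∀ {x} → x ∈ S → Generated S x
    unit  : Generated S ε
    mul   : ∀ {x y} → Generated S x → Generated S y → Generated S (x ∙ y)
    inv   : ∀ {x} → Generated S x → Generated S (x ⁻¹)
    resp  : ∀ {x y} → x ≈ y → Generated S x → Generated S y

  data NormalClosure {s} (S : Pred Carrier s) : Pred Carrier (c ⊔ ℓ ⊔ s) where
    gen   : ∀ {x} → x ∈ S → NormalClosure S x
    unit  : NormalClosure S ε
    mul   : ∀ {x y} → NormalClosure S x → NormalClosure S y → NormalClosure S (x ∙ y)
    inv   : ∀ {x} → NormalClosure S x → NormalClosure S (x ⁻¹)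
    conj  : ∀ g {x} → NormalClosure S x → NormalClosure S (g ∙ x ∙ g ⁻¹)
    resp  : ∀ {x y} → x ≈ y → NormalClosure S x → NormalClosure S y

  commutator : Carrier → Carrier → Carrier
  commutator x y = x ⁻¹ ∙ y ⁻¹ ∙ x ∙ y

  -- [P , Q] is the subgroup generated by all commutators, not merely
  -- the set of commutators.
  CommutatorSubgroup : ∀ {p q} → Pred Carrier p → Pred Carrier q →
                       Pred Carrier (c ⊔ ℓ ⊔ p ⊔ q)
  CommutatorSubgroup P Q =
    Generated λ z → ∃[ x ] ∃[ y ] x ∈ P × y ∈ Q × z ≈ commutator x y

  -- The terms H⁰ = H, Hⁿ⁺¹ = [Hⁿ , H] of the lower central series of a
  -- subgroup H, regarded as subgroups of the ambient group.
  LowerCentral : Pred Carrier (c ⊔ ℓ) → ℕ → Pred Carrier (c ⊔ ℓ)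
  LowerCentral H zero    = H
  LowerCentral H (suc n) = CommutatorSubgroup (LowerCentral H n) H

  Nilpotent : Pred Carrier (c ⊔ ℓ) → Set (c ⊔ ℓ)
  Nilpotent H = ∃[ n ] (∀ {x} → x ∈ LowerCentral H n → x ≈ ε)

  FinitelyGenerated : Pred Carrier (c ⊔ ℓ) → Set (c ⊔ ℓ)
  FinitelyGenerated H = ∃[ xs ] H ≐ Generated (_∈ˡ xs)

  LocallyNilpotent : Set (lsuc (c ⊔ ℓ))
  LocallyNilpotent = ∀ (H : Pred Carrier (c ⊔ ℓ)) → FinitelyGenerated H → Nilpotent H

-- The quotient of G by the normal subgroup generated by S: the same
-- carrier, with x and y identified when x y⁻¹ lies in the
-- normal closure of S.

module _ {c ℓ s} (G : Group c ℓ) (S : Pred (Group.Carrier G) s) where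
  open Group G
  open GroupProperties G
  open SetoidReasoning setoid

  private
    N : Pred Carrier (c ⊔ ℓ ⊔ s)
    N = NormalClosure G S

    infix 4 _~_
    _~_ : Rel Carrier (c ⊔ ℓ ⊔ s)
    x ~ y = (x ∙ y ⁻¹) ∈ N

    ≈⇒~ : ∀ {x y} → x ≈ y → x ~ y
    ≈⇒~ {x} {y} x≈y = resp (trans (sym (inverseʳ y)) (∙-congʳ (sym x≈y))) unit

    ~-sym : ∀ {x y} → x ~ y → y ~ x
    ~-sym {x} {y} p = resp eq (inv p)
      where
      eq : (x ∙ y ⁻¹) ⁻¹ ≈ y ∙ x ⁻¹
      eq = trans (⁻¹-anti-homo-∙ x (y ⁻¹)) (∙-congʳ (⁻¹-involutive y))

    ~-trans : ∀ {x y z} → x ~ y → y ~ z → x ~ z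
    ~-trans {x} {y} {z} p q = resp eq (mul p q)
      where
      eq : (x ∙ y ⁻¹) ∙ (y ∙ z ⁻¹) ≈ x ∙ z ⁻¹
      eq = begin
        (x ∙ y ⁻¹) ∙ (y ∙ z ⁻¹)  ≈⟨ assoc (x ∙ y ⁻¹) y (z ⁻¹) ⟨
        x ∙ y ⁻¹ ∙ y ∙ z ⁻¹      ≈⟨ ∙-congʳ (//-rightDividesˡ y x) ⟩
        x ∙ z ⁻¹                 ∎

    ~-∙-cong : ∀ {x y u v} → x ~ y → u ~ v → x ∙ u ~ y ∙ v
    ~-∙-cong {x} {y} {u} {v} p q = resp eq (mul (conj x q) p)
      where
      eq : (x ∙ (u ∙ v ⁻¹) ∙ x ⁻¹) ∙ (x ∙ y ⁻¹) ≈ (x ∙ u) ∙ (y ∙ v) ⁻¹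
      eq = begin
        (x ∙ (u ∙ v ⁻¹) ∙ x ⁻¹) ∙ (x ∙ y ⁻¹)  ≈⟨ assoc _ x (y ⁻¹) ⟨
        x ∙ (u ∙ v ⁻¹) ∙ x ⁻¹ ∙ x ∙ y ⁻¹      ≈⟨ ∙-congʳ (//-rightDividesˡ x _) ⟩
        x ∙ (u ∙ v ⁻¹) ∙ y ⁻¹                 ≈⟨ ∙-congʳ (assoc x u (v ⁻¹)) ⟨
        x ∙ u ∙ v ⁻¹ ∙ y ⁻¹                   ≈⟨ assoc (x ∙ u) (v ⁻¹) (y ⁻¹) ⟩
        x ∙ u ∙ (v ⁻¹ ∙ y ⁻¹)                 ≈⟨ ∙-congˡ (⁻¹-anti-homo-∙ y v) ⟨
        (x ∙ u) ∙ (y ∙ v) ⁻¹                  ∎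

    ~-⁻¹-cong : ∀ {x y} → x ~ y → x ⁻¹ ~ y ⁻¹
    ~-⁻¹-cong {x} {y} p = resp eq (conj (x ⁻¹) (~-sym p))
      where
      eq : x ⁻¹ ∙ (y ∙ x ⁻¹) ∙ (x ⁻¹) ⁻¹ ≈ x ⁻¹ ∙ (y ⁻¹) ⁻¹
      eq = begin
        x ⁻¹ ∙ (y ∙ x ⁻¹) ∙ (x ⁻¹) ⁻¹  ≈⟨ ∙-congʳ (assoc (x ⁻¹) y (x ⁻¹)) ⟨
        x ⁻¹ ∙ y ∙ x ⁻¹ ∙ (x ⁻¹) ⁻¹    ≈⟨ //-rightDividesʳ (x ⁻¹) _ ⟩
        x ⁻¹ ∙ y                       ≈⟨ ∙-congˡ (⁻¹-involutive y) ⟨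
        x ⁻¹ ∙ (y ⁻¹) ⁻¹               ∎

    isGroup′ : IsGroup _~_ _∙_ ε _⁻¹
    isGroup′ = record
      { isMonoid = record
        { isSemigroup = record
          { isMagma = record
            { isEquivalence = record
              { refl  = ≈⇒~ refl
              ; sym   = ~-sym
              ; trans = ~-trans
              }
            ; ∙-cong = ~-∙-cong
            }
          ; assoc = λ x y z → ≈⇒~ (assoc x y z)
          }
        ; identity = (λ x → ≈⇒~ (identityˡ x)) , (λ x → ≈⇒~ (identityʳ x))
        }
      ; inverse = (λ x → ≈⇒~ (inverseˡ x)) , (λ x → ≈⇒~ (inverseʳ x))
      ; ⁻¹-cong = ~-⁻¹-cong
      }

  QuotientByNormalClosure : Group c (c ⊔ ℓ ⊔ s)
  QuotientByNormalClosure = record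
    { Carrier = Carrier ; _≈_ = _~_ ; _∙_ = _∙_ ; ε = ε ; _⁻¹ = _⁻¹
    ; isGroup = isGroup′ }

-- The free group on M: group terms over M modulo the least congruence
-- that validates the group axioms.

infixl 7 _·_
infix  8 _⁻

data Term {a} (M : Set a) : Set a where
  var : M → Term M
  one : Term M
  _·_ : Term M → Term M → Term M
  _⁻  : Term M → Term M

infix 4 _≋_

data _≋_ {a} {M : Set a} : Rel (Term M) a where
  ≋-refl  : ∀ {s} → s ≋ s
  ≋-sym   : ∀ {s t} → s ≋ t → t ≋ s
  ≋-trans : ∀ {s t u} → s ≋ t → t ≋ u → s ≋ u
  ·-cong  : ∀ {s t u v} → s ≋ t → u ≋ v → s · u ≋ t · v
  ⁻-cong  : ∀ {s t} → s ≋ t → s ⁻ ≋ t ⁻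
  ·-assoc : ∀ s t u → (s · t) · u ≋ s · (t · u)
  ·-idˡ   : ∀ s → one · s ≋ s
  ·-idʳ   : ∀ s → s · one ≋ s
  ·-invˡ  : ∀ s → s ⁻ · s ≋ one
  ·-invʳ  : ∀ s → s · s ⁻ ≋ one

FreeGroup : ∀ {a} → Set a → Group a a
FreeGroup M = record
  { Carrier = Term M ; _≈_ = _≋_ ; _∙_ = _·_ ; ε = one ; _⁻¹ = _⁻
  ; isGroup = record
    { isMonoid = record
      { isSemigroup = record
        { isMagma = record
          { isEquivalence = record { refl = ≋-refl ; sym = ≋-sym ; trans = ≋-trans }
          ; ∙-cong = ·-cong
          }
        ; assoc = ·-assoc
        }
      ; identity = ·-idˡ , ·-idʳ
      }
    ; inverse = ·-invˡ , ·-invʳ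
    ; ⁻¹-cong = ⁻-cong
    }
  }

-- A finite subset of M is represented by a list of its elements, with
-- order and repetitions irrelevant.  Two lists enumerating the same
-- subset are included in each other, so an increasing c gives them the
-- same value: it is a well-defined function on finite subsets.
Increasing : ∀ {a} {M : Set a} → (List M → ℕ) → Set a
Increasing {M = M} c = ∀ {U V : List M} → U ⊆ₗ V → c U ≤ c V

module _ {a} (M : Set a) where

  FreeSubgroup : List M → Pred (Term M) a
  FreeSubgroup U = Generated (FreeGroup M) λ t → ∃[ m ] m ∈ₗ U × t ≡ var m

  Relators : (List M → ℕ) → Pred (Term M) a
  Relators c t = ∃[ U ] t ∈ LowerCentral (FreeGroup M) (FreeSubgroup U) (c U)

  Fr : (List M → ℕ) → Group a a
  Fr c = QuotientByNormalClosure (FreeGroup M) (Relators c)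

module _ {c₁ ℓ₁ c₂ ℓ₂} (G : Group c₁ ℓ₁) (H : Group c₂ ℓ₂) where
  private
    module G = Group G
    module H = Group H
  open Morphisms.GroupMorphisms G.rawGroup H.rawGroup using (IsGroupHomomorphism)

  IsEpimorphism : (G.Carrier → H.Carrier) → Set (c₁ ⊔ c₂ ⊔ ℓ₁ ⊔ ℓ₂)
  IsEpimorphism f = IsGroupHomomorphism f × Surjective G._≈_ H._≈_ f

{-# OPTIONS --safe #-}

-- Take M to be the carrier of G and let c(U) be the nilpotency class of the
-- subgroup ⟨U⟩ of G, i.e. the least n at which its lower central series is
-- trivial (found by excluded middle); it is monotone in U.  Evaluation F_M → G
-- is surjective and carries the c(U)-th lower central term of F_U into that of
-- ⟨U⟩, which is trivial; so it factors through Fr(M, c).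
module Submission where

open import Defs
open import Algebra.Bundles using (Group)
import Algebra.Morphism.Construct.Identity as Identity
import Algebra.Morphism.Structures as Morphisms
import Algebra.Properties.Group as GroupProperties
open import Axiom.ExcludedMiddle using (ExcludedMiddle)
open import Data.List.Base using (List)
import Data.List.Membership.Setoid as SetoidMembership
open import Data.List.Relation.Binary.Subset.Propositional using () renaming (_⊆_ to _⊆ₗ_)
import Data.List.Relation.Binary.Subset.Propositional.Properties as Subset
import Data.List.Relation.Unary.Any as Any
open import Data.Nat.Base using (ℕ; zero; suc; _≤_; z≤n; s≤s)
open import Data.Product.Base using (Σ-syntax; ∃-syntax; _×_; _,_; proj₁; proj₂)
open import Function.Base using (id; _∘_)
open import Level using (_⊔_)
open import Relation.Binary.PropositionalEquality.Core using (refl)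
import Relation.Binary.Reasoning.Setoid as SetoidReasoning
open import Relation.Nullary.Decidable.Core using (yes; no)
open import Relation.Nullary.Negation.Core using (contradiction)
open import Relation.Unary using (Pred; Decidable; _∈_; _⊆_)

-- The known witness `n` bounds the search: if `P` fails at 0, the shifted predicate `P ∘ suc` has a
-- smaller witness, so the recursion is structural.
least : ∀ {p} {P : Pred ℕ p} → Decidable P → ∀ n → P n →
        ∃[ m ] P m × (∀ k → P k → m ≤ k)
least P? zero    Pn = zero , Pn , λ _ _ → z≤n
least P? (suc n) Pn with P? zero
... | yes P0 = zero , P0 , λ _ _ → z≤n
... | no ¬P0 with least (P? ∘ suc) n Pn
...   | m , Pm , min = suc m , Pm , λ where
        zero    P0 → contradiction P0 ¬P0
        (suc k) Pk → s≤s (min k Pk)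

module _ {a₁ ℓ₁ a₂ ℓ₂} (G : Group a₁ ℓ₁) (H : Group a₂ ℓ₂) where
  private
    module G = Group G
    module H = Group H
  open Morphisms.GroupMorphisms G.rawGroup H.rawGroup using (IsGroupHomomorphism)

  module _ {f : G.Carrier → H.Carrier} (isHom : IsGroupHomomorphism f) where
    open IsGroupHomomorphism isHom

    Generated-map : ∀ {s t} {S : Pred G.Carrier s} {T : Pred H.Carrier t} →
                    (∀ {x} → x ∈ S → f x ∈ T) →
                    ∀ {x} → x ∈ Generated G S → f x ∈ Generated H T
    Generated-map S⇒T (gen x∈S)    = gen (S⇒T x∈S)
    Generated-map S⇒T unit         = resp (H.sym ε-homo) unit
    Generated-map S⇒T (mul p q)    =
      resp (H.sym (homo _ _)) (mul (Generated-map S⇒T p) (Generated-map S⇒T q))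
    Generated-map S⇒T (inv p)      = resp (H.sym (⁻¹-homo _)) (inv (Generated-map S⇒T p))
    Generated-map S⇒T (resp x≈y p) = resp (⟦⟧-cong x≈y) (Generated-map S⇒T p)

    commutator-homo : ∀ x y → f (commutator G x y) H.≈ commutator H (f x) (f y)
    commutator-homo x y = begin
      f (x G.⁻¹ G.∙ y G.⁻¹ G.∙ x G.∙ y)            ≈⟨ homo _ y ⟩
      f (x G.⁻¹ G.∙ y G.⁻¹ G.∙ x) H.∙ f y          ≈⟨ H.∙-congʳ (homo _ x) ⟩
      f (x G.⁻¹ G.∙ y G.⁻¹) H.∙ f x H.∙ f y        ≈⟨ H.∙-congʳ (H.∙-congʳ (homo _ _)) ⟩
      f (x G.⁻¹) H.∙ f (y G.⁻¹) H.∙ f x H.∙ f y    ≈⟨ H.∙-congʳ (H.∙-congʳ (H.∙-cong (⁻¹-homo x) (⁻¹-homo y))) ⟩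
      commutator H (f x) (f y)                     ∎
      where open SetoidReasoning H.setoid

    -- Induction on `n`: homomorphisms carry commutators to commutators, so generators of each term
    -- go to generators. Taking `f` to be the identity yields monotonicity in the subgroup; taking
    -- it to be evaluation handles the relators.
    LowerCentral-map : {P : Pred G.Carrier (a₁ ⊔ ℓ₁)} {Q : Pred H.Carrier (a₂ ⊔ ℓ₂)} →
                       (∀ {x} → x ∈ P → f x ∈ Q) →
                       ∀ n {x} → x ∈ LowerCentral G P n → f x ∈ LowerCentral H Q n
    LowerCentral-map P⇒Q zero    = P⇒Q
    LowerCentral-map P⇒Q (suc n) = Generated-map λ (x , y , x∈ , y∈ , z≈[x,y]) →
      f x , f y , LowerCentral-map P⇒Q n x∈ , P⇒Q y∈ ,
      H.trans (⟦⟧-cong z≈[x,y]) (commutator-homo x y)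

    -- The kernel of `f` is a normal subgroup, so it contains the normal closure of `S` once it
    -- contains `S`.
    NormalClosure-kernel : ∀ {s} {S : Pred G.Carrier s} →
                           (∀ {x} → x ∈ S → f x H.≈ H.ε) →
                           ∀ {x} → x ∈ NormalClosure G S → f x H.≈ H.ε
    NormalClosure-kernel {S = S} S⇒ε = go
      where
      open SetoidReasoning H.setoid
      open GroupProperties H using (ε⁻¹≈ε)

      go : ∀ {x} → x ∈ NormalClosure G S → f x H.≈ H.ε
      go (gen x∈S)    = S⇒ε x∈S
      go unit         = ε-homo
      go (mul p q)    = H.trans (homo _ _) (H.trans (H.∙-cong (go p) (go q)) (H.identityˡ H.ε))
      go (inv p)      = H.trans (⁻¹-homo _) (H.trans (H.⁻¹-cong (go p)) ε⁻¹≈ε)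
      go (conj g {x} p) = begin
        f (g G.∙ x G.∙ g G.⁻¹)       ≈⟨ homo _ _ ⟩
        f (g G.∙ x) H.∙ f (g G.⁻¹)   ≈⟨ H.∙-cong (homo g x) (⁻¹-homo g) ⟩
        f g H.∙ f x H.∙ f g H.⁻¹     ≈⟨ H.∙-congʳ (H.∙-congˡ (go p)) ⟩
        f g H.∙ H.ε H.∙ f g H.⁻¹     ≈⟨ H.∙-congʳ (H.identityʳ (f g)) ⟩
        f g H.∙ f g H.⁻¹             ≈⟨ H.inverseʳ (f g) ⟩
        H.ε                          ∎
      go (resp x≈y p) = H.trans (⟦⟧-cong (G.sym x≈y)) (go p)

    quotient-lift : ∀ {s} {S : Pred G.Carrier s} →
                    (∀ {x} → x ∈ S → f x H.≈ H.ε) →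
                    Morphisms.GroupMorphisms.IsGroupHomomorphism
                      (Group.rawGroup (QuotientByNormalClosure G S)) H.rawGroup f
    quotient-lift S⇒ε = record
      { isMonoidHomomorphism = record
        { isMagmaHomomorphism = record
          { isRelHomomorphism = record
            -- The quotient keeps the carrier and operations of `G`, so only compatibility with the
            -- coarser equality is new.
            { cong = λ {x} {y} x~y → x∙y⁻¹≈ε⇒x≈y (f x) (f y)
                (H.trans (H.sym (H.trans (homo x (y G.⁻¹)) (H.∙-congˡ (⁻¹-homo y))))
                         (NormalClosure-kernel S⇒ε x~y)) }
          ; homo = homo
          }
        ; ε-homo = ε-homo
        }
      ; ⁻¹-homo = ⁻¹-homo
      }
      where open GroupProperties H using (x∙y⁻¹≈ε⇒x≈y)

module _ {a ℓ} (G : Group a ℓ) where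
  open Group G renaming (refl to ≈-refl; sym to ≈-sym; trans to ≈-trans)
  open SetoidMembership setoid using () renaming (_∈_ to _∈ˡ_)

  -- The homomorphism that the universal property of the free group assigns to the identity map on
  -- generators.
  eval : Term Carrier → Carrier
  eval (var x) = x
  eval one     = ε
  eval (s · t) = eval s ∙ eval t
  eval (t ⁻)   = eval t ⁻¹

  eval-cong : ∀ {s t} → s ≋ t → eval s ≈ eval t
  eval-cong ≋-refl          = ≈-refl
  eval-cong (≋-sym p)       = ≈-sym (eval-cong p)
  eval-cong (≋-trans p q)   = ≈-trans (eval-cong p) (eval-cong q)
  eval-cong (·-cong p q)    = ∙-cong (eval-cong p) (eval-cong q)
  eval-cong (⁻-cong p)      = ⁻¹-cong (eval-cong p)
  eval-cong (·-assoc s t u) = assoc (eval s) (eval t) (eval u)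
  eval-cong (·-idˡ s)       = identityˡ (eval s)
  eval-cong (·-idʳ s)       = identityʳ (eval s)
  eval-cong (·-invˡ s)      = inverseˡ (eval s)
  eval-cong (·-invʳ s)      = inverseʳ (eval s)

  eval-isGroupHomomorphism :
    Morphisms.GroupMorphisms.IsGroupHomomorphism
      (Group.rawGroup (FreeGroup Carrier)) rawGroup eval
  eval-isGroupHomomorphism = record
    { isMonoidHomomorphism = record
      { isMagmaHomomorphism = record
        { isRelHomomorphism = record { cong = eval-cong }
        ; homo = λ _ _ → ≈-refl
        }
      ; ε-homo = ≈-refl
      }
    ; ⁻¹-homo = λ _ → ≈-refl
    }

  ⟨_⟩ : List Carrier → Pred Carrier (a ⊔ ℓ)
  ⟨ U ⟩ = Generated G (_∈ˡ U)

  ⟨⟩-mono : ∀ {U V} → U ⊆ₗ V → ⟨ U ⟩ ⊆ ⟨ V ⟩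
  ⟨⟩-mono U⊆V = Generated-map G G (Identity.isGroupHomomorphism rawGroup ≈-refl)
                  (Subset.Any-resp-⊆ U⊆V)

  eval-FreeSubgroup : ∀ U {t} → t ∈ FreeSubgroup Carrier U → eval t ∈ ⟨ U ⟩
  eval-FreeSubgroup U = Generated-map (FreeGroup Carrier) G eval-isGroupHomomorphism
    -- `FreeSubgroup` uses propositional membership in `U`, while `⟨ U ⟩` uses membership up to `≈`.
    λ { (_ , m∈U , refl) → Any.map reflexive m∈U }

  LowerCentralTrivial : Pred Carrier (a ⊔ ℓ) → Pred ℕ (a ⊔ ℓ)
  LowerCentralTrivial H n = ∀ {x} → x ∈ LowerCentral G H n → x ≈ ε

proposition2p6 : ∀ {a ℓ} → ExcludedMiddle (a ⊔ ℓ) →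
    (G : Group a ℓ) → LocallyNilpotent G →
    Σ[ M ∈ Set a ] Σ[ c ∈ (List M → ℕ) ]
    Increasing c ×
    (∃[ f ] IsEpimorphism (Fr M c) G f)
proposition2p6 em G locNil =
  Carrier , class , class-increasing , eval G ,
  -- `eval G (var x)` is `x` by definition; congruence covers every term identified with `var x` in
  -- the quotient.
  liftHom , λ x → var x , IsGroupHomomorphism.⟦⟧-cong liftHom
  where
  open Group G using (Carrier; rawGroup; _≈_; ε) renaming (refl to ≈-refl)
  open Morphisms.GroupMorphisms using (module IsGroupHomomorphism)

  F = FreeGroup Carrier
  evalHom = eval-isGroupHomomorphism G

  -- Local nilpotency supplies some index for each `U`, but arbitrary choices need not increase with
  -- `U`; the least one does.
  leastTrivial : ∀ U → ∃[ n ] LowerCentralTrivial G (⟨_⟩ G U) n ×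
                   (∀ k → LowerCentralTrivial G (⟨_⟩ G U) k → n ≤ k)
  leastTrivial U = let n , trivial = locNil (⟨_⟩ G U) (U , id , id)
                   in least {P = LowerCentralTrivial G (⟨_⟩ G U)} (λ _ → em) n trivial

  class : List Carrier → ℕ
  class U = proj₁ (leastTrivial U)

  class-trivial : ∀ U → LowerCentralTrivial G (⟨_⟩ G U) (class U)
  class-trivial U = proj₁ (proj₂ (leastTrivial U))

  class-increasing : Increasing class
  -- The term of index `class V` for `U` lies inside the one for `V`, which is trivial; minimality
  -- of `class U` gives the bound.
  class-increasing {U} {V} U⊆V = proj₂ (proj₂ (leastTrivial U)) (class V)
    (class-trivial V ∘ LowerCentral-map G G (Identity.isGroupHomomorphism rawGroup ≈-refl)
                         (⟨⟩-mono G U⊆V) (class V))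

  Relators-trivial : ∀ {t} → t ∈ Relators Carrier class → eval G t ≈ ε
  Relators-trivial (U , t∈) =
    class-trivial U (LowerCentral-map F G evalHom (eval-FreeSubgroup G U) (class U) t∈)

  liftHom = quotient-lift F G evalHom Relators-trivial
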